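{- For every positive integer $n$, $$\max\bigl(4,\log_2(n+4)\bigr)\le t(n).$$ In particular, $t(n)\to\infty$ as $n\to\infty$.
   Context: A $\mathbb Z$-lattice is a free $\mathbb Z$-module of finite rank equipped with a positive definite symmetric bilinear form with values in $\mathbb Z$; $Q(\bm x)=B(\bm x,\bm x)$. An integer $m$ is represented by $L$ if $m=Q(\bm x)$ for some $\bm x\in L$. For a positive integer $n$, $\mathcal T(n)$ is the set of all integers $\ge n$. A $\mathbb Z$-lattice $L$ is tight $\mathcal T(n)$-universal if the set of nonzero integers represented by $L$ is exactly $\mathcal T(n)$. $t(n)$ denotes the smallest rank of a tight $\mathcal T(n)$-universal $\mathbb Z$-lattice. -}

module Defs where

open import Data.Nat as ℕ using (ℕ; zero; suc)
open import Data.Integer using (ℤ; +_; _+_; _*_; _≤_; _<_; 0ℤ)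
open import Data.Fin using (Fin; zero; suc)
open import Data.Product using (Σ; ∃; _×_; _,_)
open import Relation.Binary.PropositionalEquality using (_≡_)
open import Relation.Nullary using (¬_)
open import Function.Bundles using (_⇔_)

∑ : (r : ℕ) → (Fin r → ℤ) → ℤ
∑ zero    f = 0ℤ
∑ (suc r) f = f zero + ∑ r (λ i → f (suc i))

-- A ℤ-lattice of rank r, given by its Gram matrix with respect to a ℤ-basis:
-- symmetric, integer-valued, positive definite.
record Lattice (r : ℕ) : Set where
  field
    gram      : Fin r → Fin r → ℤ
    symmetric : ∀ i j → gram i j ≡ gram j i

  B : (Fin r → ℤ) → (Fin r → ℤ) → ℤ
  B x y = ∑ r (λ i → ∑ r (λ j → x i * gram i j * y j))

  Q : (Fin r → ℤ) → ℤ
  Q x = B x x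

  field
    posDef : ∀ (x : Fin r → ℤ) → ¬ (∀ i → x i ≡ 0ℤ) → 0ℤ < Q x

open Lattice public

Represents : {r : ℕ} → Lattice r → ℤ → Set
Represents {r} L m = Σ (Fin r → ℤ) (λ x → Q L x ≡ m)

TightUniversal : (n : ℕ) → {r : ℕ} → Lattice r → Set
TightUniversal n L = ∀ (m : ℤ) → ¬ (m ≡ 0ℤ) → (Represents L m ⇔ (+ n ≤ m))

IsT : ℕ → ℕ → Set
IsT n r = Σ (Lattice r) (TightUniversal n)
        × (∀ (s : ℕ) (L : Lattice s) → TightUniversal n L → r ℕ.≤ s)

{-# OPTIONS --safe #-}
-- Let L be tight T(n)-universal of rank r, so that every nonzero vector has norm at least n.
--
-- n + 4 ≤ 2^r for n ≥ 2: two vectors congruent modulo 2L and not equal up to sign are x = u + v, y = u − v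
-- with u, v ≠ 0, hence Q x + Q y = 2 (Q u + Q v) ≥ 4n, while Q x − Q y = 4 B(u,v).  Among vectors of norms
-- 0, n, n+1, …, 2n+2 a coincidence of classes is therefore only possible between 2n−2 and 2n+2, and it produces
-- u, v of norm n with B(u,v) = 1.  Then u, v and vectors of norms 0, n+1, …, 2n+1 are pairwise incongruent.
--
-- r ≥ 4: for n ≥ 5 this follows from n + 4 ≤ 2^r.  If r ≤ 3, the Gram matrix of any four vectors is positive
-- semidefinite and singular.  For each n ≤ 4 one chooses successively represented norms n, n+1, t₃, t₄, each
-- depending on the inner products of the vectors found so far, such that no integral Gram matrix with this
-- diagonal is positive semidefinite and singular; the inner products are bounded, so this is a finite check.
module Submission where

open import Defs
open import Data.Nat as ℕ using (ℕ; zero; suc; ⌊_/2⌋)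
import Data.Nat.Properties as ℕ
open import Data.Integer using (ℤ; +_; -[1+_]; _+_; _-_; _*_; -_; _≤_; _<_; 0ℤ; 1ℤ; -1ℤ; ∣_∣; _≟_; +≤+; -≤+; +<+)
import Data.Integer.Properties as ℤ
open import Data.Integer.DivMod using (_/ℕ_; _%ℕ_; n%ℕd<d; a≡a%ℕn+[a/ℕn]*n)
open import Data.Integer.Tactic.RingSolver using (solve-∀)
open import Data.Bool using (Bool; true; false; _∧_; _∨_; not; T)
open import Data.Bool.Properties using (T-∧; T-∨; T-≡)
open import Data.Fin as Fin using (Fin; zero; suc; toℕ; fromℕ<; punchIn; punchOut; funToFin; finToFun)
import Data.Fin.Properties as Fin
open import Data.Product using (Σ; ∃; ∃₂; _×_; _,_; proj₁; proj₂)
open import Data.Sum using (inj₁; inj₂; [_,_]′)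
open import Data.Empty using (⊥)
open import Function.Bundles using (Equivalence)
open import Relation.Nullary using (¬_; yes; no; contradiction)
open import Relation.Binary.PropositionalEquality using (_≡_; _≢_; refl; sym; trans; cong; cong₂; subst; subst₂; module ≡-Reasoning)

-- Integral quadratic forms

+-congˡ : ∀ i {j k} → j ≡ k → i + j ≡ i + k
+-congˡ i = cong (λ j → i + j)

∑-cong : ∀ k {f g : Fin k → ℤ} → (∀ i → f i ≡ g i) → ∑ k f ≡ ∑ k g
∑-cong zero    f≡g = refl
∑-cong (suc k) f≡g = cong₂ _+_ (f≡g zero) (∑-cong k (λ i → f≡g (suc i)))

∑-zero : ∀ k → ∑ k (λ _ → 0ℤ) ≡ 0ℤ
∑-zero zero    = refl
∑-zero (suc k) = trans (ℤ.+-identityˡ _) (∑-zero k)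

∑-distrib-+ : ∀ k (f g : Fin k → ℤ) → ∑ k (λ i → f i + g i) ≡ ∑ k f + ∑ k g
∑-distrib-+ zero    f g = refl
∑-distrib-+ (suc k) f g = trans
  (+-congˡ (f zero + g zero) (∑-distrib-+ k (λ i → f (suc i)) (λ i → g (suc i))))
  (interchange (f zero) (g zero) _ _)
  where
  interchange : ∀ a b c d → a + b + (c + d) ≡ a + c + (b + d)
  interchange = solve-∀

*-distribˡ-∑ : ∀ k a (f : Fin k → ℤ) → a * ∑ k f ≡ ∑ k (λ i → a * f i)
*-distribˡ-∑ zero    a f = ℤ.*-zeroʳ a
*-distribˡ-∑ (suc k) a f = trans (ℤ.*-distribˡ-+ a (f zero) _)
  (+-congˡ (a * f zero) (*-distribˡ-∑ k a (λ i → f (suc i))))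

∑-linear : ∀ k a b (f g : Fin k → ℤ) →
           ∑ k (λ i → a * f i + b * g i) ≡ a * ∑ k f + b * ∑ k g
∑-linear k a b f g = trans (∑-distrib-+ k _ _)
  (sym (cong₂ _+_ (*-distribˡ-∑ k a f) (*-distribˡ-∑ k b g)))

∑-comm : ∀ k l (f : Fin k → Fin l → ℤ) →
         ∑ k (λ i → ∑ l (f i)) ≡ ∑ l (λ j → ∑ k (λ i → f i j))
∑-comm zero    l f = sym (∑-zero l)
∑-comm (suc k) l f = trans
  (+-congˡ (∑ l (f zero)) (∑-comm k l (λ i → f (suc i))))
  (sym (∑-distrib-+ l (f zero) (λ j → ∑ k (λ i → f (suc i) j))))

-- Homogeneous linear systems over ℤ

*-cancelˡ-≢0 : ∀ {a i} → a ≢ 0ℤ → a * i ≡ 0ℤ → i ≡ 0ℤ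
*-cancelˡ-≢0 {a} a≢0 ai≡0 with ℤ.i*j≡0⇒i≡0∨j≡0 a ai≡0
... | inj₁ a≡0 = contradiction a≡0 a≢0
... | inj₂ i≡0 = i≡0

-- Gaussian elimination without division, by induction on the number of unknowns. A zero first
-- column is solved by the first unit vector; otherwise a nonzero entry `a` in row `p` serves as
-- pivot.
underdetermined : ∀ {r k} → r ℕ.< k → (A : Fin r → Fin k → ℤ) →
                  ∃ λ (x : Fin k → ℤ) → ¬ (∀ i → x i ≡ 0ℤ) × (∀ j → ∑ k (λ i → x i * A j i) ≡ 0ℤ)
underdetermined {r} {suc k} r<k A with Fin.all? (λ j → A j zero ≟ 0ℤ)
... | yes A₀≡0 = x , (λ x≡0 → contradiction (x≡0 zero) λ ()) , vanish
  where
  x : Fin (suc k) → ℤ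
  x zero    = 1ℤ
  x (suc _) = 0ℤ
  vanish : ∀ j → ∑ (suc k) (λ i → x i * A j i) ≡ 0ℤ
  vanish j = cong₂ _+_ (trans (ℤ.*-identityˡ _) (A₀≡0 j))
                       (trans (∑-cong k (λ i → ℤ.*-zeroˡ (A j (suc i)))) (∑-zero k))
underdetermined {zero} {suc k} r<k A | no A₀≢0 = contradiction (λ ()) A₀≢0
underdetermined {suc r} {suc k} (ℕ.s≤s r<k) A | no A₀≢0
  with Fin.¬∀⟶∃¬ (suc r) _ (λ j → A j zero ≟ 0ℤ) A₀≢0
... | p , a≢0 = x , x≢0 , vanish
  where
  a : ℤ
  a = A p zero
  rest : Fin (suc r) → Fin k → ℤ
  rest j i = A j (suc i)
  -- Cross-multiplying with the pivot row cancels the first entry of every other row, leaving one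
  -- equation and one unknown fewer.
  IH = underdetermined r<k (λ j i → a * rest (punchIn p j) i + - A (punchIn p j) zero * rest p i)
  y : Fin k → ℤ
  y = proj₁ IH
  S : Fin (suc r) → ℤ
  S j = ∑ k (λ i → y i * rest j i)
  -- Scaling `y` by the pivot lets the pivot equation be solved for the first unknown without
  -- fractions.
  x : Fin (suc k) → ℤ
  x zero    = - S p
  x (suc i) = a * y i
  x≢0 : ¬ (∀ i → x i ≡ 0ℤ)
  x≢0 x≡0 = proj₁ (proj₂ IH) y≡0
    where
    y≡0 : ∀ i → y i ≡ 0ℤ
    y≡0 i = *-cancelˡ-≢0 a≢0 (x≡0 (suc i))
  collect : ∀ j → ∑ (suc k) (λ i → x i * A j i) ≡ - S p * A j zero + a * S j
  collect j = +-congˡ (- S p * A j zero)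
    (trans (∑-cong k (λ i → ℤ.*-assoc a (y i) (rest j i))) (sym (*-distribˡ-∑ k a _)))
  others : ∀ j → - S p * A (punchIn p j) zero + a * S (punchIn p j) ≡ 0ℤ
  others j = begin
    - S p * A (punchIn p j) zero + a * S (punchIn p j)
      ≡⟨ swap (S p) _ a _ ⟩
    a * S (punchIn p j) + - A (punchIn p j) zero * S p
      ≡⟨ ∑-linear k a (- A (punchIn p j) zero) _ _ ⟨
    ∑ k (λ i → a * (y i * rest (punchIn p j) i) + - A (punchIn p j) zero * (y i * rest p i))
      ≡⟨ ∑-cong k (λ i → pull a (- A (punchIn p j) zero) (y i) _ _) ⟩
    ∑ k (λ i → y i * (a * rest (punchIn p j) i + - A (punchIn p j) zero * rest p i))
      ≡⟨ proj₂ (proj₂ IH) j ⟩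
    0ℤ ∎
    where
    open ≡-Reasoning
    swap : ∀ s b a t → - s * b + a * t ≡ a * t + - b * s
    swap = solve-∀
    pull : ∀ a b y u v → a * (y * u) + b * (y * v) ≡ y * (a * u + b * v)
    pull = solve-∀
  vanish : ∀ j → ∑ (suc k) (λ i → x i * A j i) ≡ 0ℤ
  vanish j with p Fin.≟ j
  ... | yes refl = trans (collect p) (cancel (S p) a)
    where
    cancel : ∀ s a → - s * a + a * s ≡ 0ℤ
    cancel = solve-∀
  ... | no p≢j = subst (λ j → ∑ (suc k) (λ i → x i * A j i) ≡ 0ℤ) (Fin.punchIn-punchOut p≢j)
    (trans (collect (punchIn p (punchOut p≢j))) (others (punchOut p≢j)))

-- Schur complements of integral forms

form : ∀ k → (Fin k → Fin k → ℤ) → (Fin k → ℤ) → (Fin k → ℤ) → ℤ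
form k M x y = ∑ k (λ i → ∑ k (λ j → x i * M i j * y j))

-- The Schur complement of the top left entry, multiplied by that entry to stay integral.
schur : ∀ {k} → (Fin (suc k) → Fin (suc k) → ℤ) → Fin k → Fin k → ℤ
schur M i j = M zero zero * M (suc i) (suc j) - M zero (suc i) * M zero (suc j)

minor : ∀ {k} → (Fin (suc k) → Fin (suc k) → ℤ) → Fin k → Fin k → ℤ
minor M i j = M (suc i) (suc j)

Symmetric : ∀ {k} → (Fin k → Fin k → ℤ) → Set
Symmetric M = ∀ i j → M i j ≡ M j i

Semidefinite : ∀ k → (Fin k → Fin k → ℤ) → Set
Semidefinite k M = ∀ x → 0ℤ ≤ form k M x x

Isotropic : ∀ k → (Fin k → Fin k → ℤ) → Set
Isotropic k M = ∃ λ x → ¬ (∀ i → x i ≡ 0ℤ) × form k M x x ≡ 0ℤ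

form-bordered : ∀ k M → Symmetric M → ∀ x → let y = λ i → x (suc i); ℓ = ∑ k (λ j → M zero (suc j) * y j) in
  form (suc k) M x x ≡ x zero * M zero zero * x zero + + 2 * (x zero * ℓ) + form k (minor M) y y
form-bordered k M M-sym x = begin
  x₀ * M zero zero * x₀ + ∑ k (λ j → x₀ * M zero (suc j) * y j)
    + ∑ k (λ i → y i * M (suc i) zero * x₀ + ∑ k (λ j → y i * minor M i j * y j))
    ≡⟨ cong₂ (λ s t → x₀ * M zero zero * x₀ + s + t) row (trans (∑-distrib-+ k _ _) (cong₂ _+_ column refl)) ⟩
  x₀ * M zero zero * x₀ + x₀ * ℓ + (x₀ * ℓ + F)
    ≡⟨ gather (x₀ * M zero zero * x₀) (x₀ * ℓ) F ⟩
  x₀ * M zero zero * x₀ + + 2 * (x₀ * ℓ) + F ∎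
  where
  open ≡-Reasoning
  x₀ = x zero
  y : Fin k → ℤ
  y i = x (suc i)
  ℓ = ∑ k (λ j → M zero (suc j) * y j)
  F = form k (minor M) y y
  row : ∑ k (λ j → x₀ * M zero (suc j) * y j) ≡ x₀ * ℓ
  row = trans (∑-cong k (λ j → ℤ.*-assoc x₀ _ _)) (sym (*-distribˡ-∑ k x₀ _))
  flip : ∀ a b c → a * b * c ≡ c * b * a
  flip = solve-∀
  column : ∑ k (λ i → y i * M (suc i) zero * x₀) ≡ x₀ * ℓ
  column = trans (∑-cong k (λ i → trans (flip (y i) _ x₀) (cong (λ m → x₀ * m * y i) (M-sym (suc i) zero)))) row
  gather : ∀ a b c → a + b + (b + c) ≡ a + + 2 * b + c
  gather = solve-∀

form-schur : ∀ k M y → let ℓ = ∑ k (λ j → M zero (suc j) * y j) in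
  form k (schur M) y y ≡ M zero zero * form k (minor M) y y - ℓ * ℓ
form-schur k M y = begin
  ∑ k (λ i → ∑ k (λ j → y i * (a * minor M i j - r i * r j) * y j))
    ≡⟨ ∑-cong k (λ i → trans (∑-cong k (λ j → spread (y i) a (minor M i j) (r i) (r j) (y j)))
                             (∑-linear k a (- (r i * y i)) _ _)) ⟩
  ∑ k (λ i → a * ∑ k (λ j → y i * minor M i j * y j) + - (r i * y i) * ℓ)
    ≡⟨ ∑-cong k (λ i → +-congˡ (a * ∑ k (λ j → y i * minor M i j * y j)) (move (r i * y i) ℓ)) ⟩
  ∑ k (λ i → a * ∑ k (λ j → y i * minor M i j * y j) + - ℓ * (r i * y i))
    ≡⟨ ∑-linear k a (- ℓ) _ _ ⟩
  a * form k (minor M) y y + - ℓ * ℓ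
    ≡⟨ +-congˡ (a * form k (minor M) y y) (sym (ℤ.neg-distribˡ-* ℓ ℓ)) ⟩
  a * form k (minor M) y y - ℓ * ℓ ∎
  where
  open ≡-Reasoning
  a = M zero zero
  r : Fin k → ℤ
  r i = M zero (suc i)
  ℓ = ∑ k (λ j → r j * y j)
  spread : ∀ u a m r s v → u * (a * m - r * s) * v ≡ a * (u * m * v) + - (r * u) * (s * v)
  spread = solve-∀
  move : ∀ u v → - u * v ≡ - v * u
  move = solve-∀

-- Multiplying the form by its leading entry keeps the completed square integral, so that questions
-- about the form pass to one variable fewer.
complete-square : ∀ k M → Symmetric M → ∀ x →
  let a = M zero zero; y = λ i → x (suc i); h = a * x zero + ∑ k (λ j → M zero (suc j) * y j) in
  a * form (suc k) M x x ≡ h * h + form k (schur M) y y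
complete-square k M M-sym x = begin
  a * form (suc k) M x x
    ≡⟨ cong (a *_) (form-bordered k M M-sym x) ⟩
  a * (x zero * a * x zero + + 2 * (x zero * ℓ) + form k (minor M) y y)
    ≡⟨ square a (x zero) ℓ (form k (minor M) y y) ⟩
  (a * x zero + ℓ) * (a * x zero + ℓ) + (a * form k (minor M) y y - ℓ * ℓ)
    ≡⟨ +-congˡ ((a * x zero + ℓ) * (a * x zero + ℓ)) (form-schur k M y) ⟨
  (a * x zero + ℓ) * (a * x zero + ℓ) + form k (schur M) y y ∎
  where
  open ≡-Reasoning
  a = M zero zero
  y : Fin k → ℤ
  y i = x (suc i)
  ℓ = ∑ k (λ j → M zero (suc j) * y j)
  square : ∀ a x ℓ f → a * (x * a * x + + 2 * (x * ℓ) + f) ≡ (a * x + ℓ) * (a * x + ℓ) + (a * f - ℓ * ℓ)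
  square = solve-∀

square-nonneg : ∀ i → 0ℤ ≤ i * i
square-nonneg (+ n)    = subst (0ℤ ≤_) (ℤ.pos-* n n) (+≤+ ℕ.z≤n)
square-nonneg -[1+ n ] = +≤+ ℕ.z≤n

*-cancelˡ-nonneg : ∀ {a i} → 0ℤ < a → 0ℤ ≤ a * i → 0ℤ ≤ i
*-cancelˡ-nonneg {+ suc n} {i} _ 0≤ai =
  ℤ.*-cancelˡ-≤-pos 0ℤ i (+ suc n) (subst (_≤ + suc n * i) (sym (ℤ.*-zeroʳ (+ suc n))) 0≤ai)
*-cancelˡ-nonneg {+ 0} (+<+ ())

*-nonneg : ∀ {i j} → 0ℤ ≤ i → 0ℤ ≤ j → 0ℤ ≤ i * j
*-nonneg {+ m} {+ n} _ _ = subst (0ℤ ≤_) (ℤ.pos-* m n) (+≤+ ℕ.z≤n)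

sum-zero : ∀ {i j} → 0ℤ ≤ i → 0ℤ ≤ j → i + j ≡ 0ℤ → i ≡ 0ℤ × j ≡ 0ℤ
sum-zero {+ zero} {+ n} _ _ eq = refl , eq

square-zero : ∀ i → i * i ≡ 0ℤ → i ≡ 0ℤ
square-zero i eq with ℤ.i*j≡0⇒i≡0∨j≡0 i eq
... | inj₁ p = p
... | inj₂ p = p

schur-symmetric : ∀ {k} (M : Fin (suc k) → Fin (suc k) → ℤ) → Symmetric M → Symmetric (schur M)
schur-symmetric M M-sym i j = cong₂ (λ s t → M zero zero * s - t)
  (M-sym (suc i) (suc j)) (ℤ.*-comm (M zero (suc i)) (M zero (suc j)))

minor-semidefinite : ∀ {k} (M : Fin (suc k) → Fin (suc k) → ℤ) → Symmetric M →
                     Semidefinite (suc k) M → Semidefinite k (minor M)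
minor-semidefinite {k} M M-sym M≥0 y = subst (0ℤ ≤_)
  (trans (form-bordered k M M-sym x) (ℤ.+-identityˡ _)) (M≥0 x)
  where
  x : Fin (suc k) → ℤ
  x zero    = 0ℤ
  x (suc i) = y i

-- Completing the square vanishes at x = (−ℓ(y), a y).
schur-semidefinite : ∀ {k} (M : Fin (suc k) → Fin (suc k) → ℤ) → Symmetric M → 0ℤ < M zero zero →
                     Semidefinite (suc k) M → Semidefinite k (schur M)
schur-semidefinite {k} M M-sym a>0 M≥0 y =
  *-cancelˡ-nonneg a>0 (*-cancelˡ-nonneg a>0 (subst (0ℤ ≤_) scaled (*-nonneg (ℤ.<⇒≤ a>0) (M≥0 x))))
  where
  open ≡-Reasoning
  a = M zero zero
  ℓ = ∑ k (λ j → M zero (suc j) * y j)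
  x : Fin (suc k) → ℤ
  x zero    = - ℓ
  x (suc i) = a * y i
  ℓ-scaled : ∑ k (λ j → M zero (suc j) * (a * y j)) ≡ a * ℓ
  ℓ-scaled = trans (∑-cong k (λ j → swap (M zero (suc j)) a (y j))) (sym (*-distribˡ-∑ k a _))
    where
    swap : ∀ m a y → m * (a * y) ≡ a * (m * y)
    swap = solve-∀
  form-scaled : form k (schur M) (λ i → a * y i) (λ i → a * y i) ≡ a * (a * form k (schur M) y y)
  form-scaled = trans
    (∑-cong k (λ i → trans (∑-cong k (λ j → pull a (y i) (schur M i j) (y j)))
                           (trans (sym (*-distribˡ-∑ k a _)) (cong (a *_) (sym (*-distribˡ-∑ k a _))))))
    (trans (sym (*-distribˡ-∑ k a _)) (cong (a *_) (sym (*-distribˡ-∑ k a _))))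
    where
    pull : ∀ a u m v → a * u * m * (a * v) ≡ a * (a * (u * m * v))
    pull = solve-∀
  cancel : ∀ a ℓ f → (a * - ℓ + a * ℓ) * (a * - ℓ + a * ℓ) + f ≡ f
  cancel = solve-∀
  scaled : a * form (suc k) M x x ≡ a * (a * form k (schur M) y y)
  scaled = begin
    a * form (suc k) M x x
      ≡⟨ complete-square k M M-sym x ⟩
    _ ≡⟨ cong₂ (λ s t → (a * - ℓ + s) * (a * - ℓ + s) + t) ℓ-scaled form-scaled ⟩
    _ ≡⟨ cancel a ℓ _ ⟩
    a * (a * form k (schur M) y y) ∎

-- Both terms of the completed square are nonnegative with sum zero, so both vanish. A zero tail `y`
-- would then force a x₀ = 0 and hence x = 0.
schur-isotropic : ∀ {k} (M : Fin (suc k) → Fin (suc k) → ℤ) → Symmetric M → 0ℤ < M zero zero →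
                  Semidefinite (suc k) M → Isotropic (suc k) M → Isotropic k (schur M)
schur-isotropic {k} M M-sym a>0 M≥0 (x , x≢0 , Mx≡0) = y , y≢0 , proj₂ both-zero
  where
  a = M zero zero
  y : Fin k → ℤ
  y i = x (suc i)
  ℓ = ∑ k (λ j → M zero (suc j) * y j)
  both-zero : (a * x zero + ℓ) * (a * x zero + ℓ) ≡ 0ℤ × form k (schur M) y y ≡ 0ℤ
  both-zero = sum-zero {(a * x zero + ℓ) * (a * x zero + ℓ)} {form k (schur M) y y}
    (square-nonneg (a * x zero + ℓ)) (schur-semidefinite M M-sym a>0 M≥0 y) total
    where
    total : (a * x zero + ℓ) * (a * x zero + ℓ) + form k (schur M) y y ≡ 0ℤ
    total = trans (sym (complete-square k M M-sym x)) (trans (cong (a *_) Mx≡0) (ℤ.*-zeroʳ a))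
  y≢0 : ¬ (∀ i → y i ≡ 0ℤ)
  y≢0 y≡0 = x≢0 λ { zero → x₀≡0 ; (suc i) → y≡0 i }
    where
    ℓ≡0 : ℓ ≡ 0ℤ
    ℓ≡0 = trans (∑-cong k (λ j → trans (cong (M zero (suc j) *_) (y≡0 j)) (ℤ.*-zeroʳ (M zero (suc j))))) (∑-zero k)
    ax₀≡0 : a * x zero ≡ 0ℤ
    ax₀≡0 = trans (sym (ℤ.+-identityʳ (a * x zero)))
      (trans (+-congˡ (a * x zero) (sym ℓ≡0)) (square-zero (a * x zero + ℓ) (proj₁ both-zero)))
    x₀≡0 : x zero ≡ 0ℤ
    x₀≡0 = *-cancelˡ-≢0 (λ a≡0 → ℤ.<⇒≢ a>0 (sym a≡0)) ax₀≡0

-- Gram matrices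

combine : ∀ {r} → ℤ → (Fin r → ℤ) → ℤ → (Fin r → ℤ) → Fin r → ℤ
combine a x b y i = a * x i + b * y i

linear : ∀ {r} k → (Fin k → ℤ) → (Fin k → Fin r → ℤ) → Fin r → ℤ
linear k c v j = ∑ k (λ i → c i * v i j)

module _ {r : ℕ} (L : Lattice r) where

  B-cong : ∀ {x x′ y y′} → (∀ i → x i ≡ x′ i) → (∀ i → y i ≡ y′ i) → B L x y ≡ B L x′ y′
  B-cong x≡x′ y≡y′ = ∑-cong r λ i → ∑-cong r λ j → cong₂ (λ s t → s * gram L i j * t) (x≡x′ i) (y≡y′ j)

  B-sym : ∀ x y → B L x y ≡ B L y x
  B-sym x y = trans (∑-comm r r _) (∑-cong r λ j → ∑-cong r λ i →
    trans (cong (λ g → x i * g * y j) (symmetric L i j)) (flip (x i) (gram L j i) (y j)))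
    where
    flip : ∀ a b c → a * b * c ≡ c * b * a
    flip = solve-∀

  B-combineˡ : ∀ a x b y z → B L (combine a x b y) z ≡ a * B L x z + b * B L y z
  B-combineˡ a x b y z = trans
    (∑-cong r λ i → trans (∑-cong r λ j → distrib a (x i) b (y i) (gram L i j) (z j)) (∑-linear r a b _ _))
    (∑-linear r a b _ _)
    where
    distrib : ∀ a x b y g z → (a * x + b * y) * g * z ≡ a * (x * g * z) + b * (y * g * z)
    distrib = solve-∀

  B-zeroˡ : ∀ {x} → (∀ i → x i ≡ 0ℤ) → ∀ y → B L x y ≡ 0ℤ
  B-zeroˡ {x} x≡0 y = trans
    (∑-cong r λ i → trans (∑-cong r λ j → cong (λ s → s * gram L i j * y j) (x≡0 i)) (∑-zero r))
    (∑-zero r)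

  Q-combine : ∀ a x b y → Q L (combine a x b y) ≡ a * a * Q L x + + 2 * (a * b * B L x y) + b * b * Q L y
  Q-combine a x b y = begin
    B L z z
      ≡⟨ B-combineˡ a x b y z ⟩
    a * B L x z + b * B L y z
      ≡⟨ cong₂ (λ s t → a * s + b * t) (trans (B-sym x z) (B-combineˡ a x b y x)) (trans (B-sym y z) (B-combineˡ a x b y y)) ⟩
    a * (a * Q L x + b * B L y x) + b * (a * B L x y + b * Q L y)
      ≡⟨ cong (λ s → a * (a * Q L x + b * s) + b * (a * B L x y + b * Q L y)) (B-sym y x) ⟩
    a * (a * Q L x + b * B L x y) + b * (a * B L x y + b * Q L y)
      ≡⟨ expand a b (Q L x) (B L x y) (Q L y) ⟩
    a * a * Q L x + + 2 * (a * b * B L x y) + b * b * Q L y ∎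
    where
    open ≡-Reasoning
    z = combine a x b y
    expand : ∀ a b p q s → a * (a * p + b * q) + b * (a * q + b * s) ≡ a * a * p + + 2 * (a * b * q) + b * b * s
    expand = solve-∀

  Q-sum : ∀ x y → Q L (combine 1ℤ x 1ℤ y) ≡ Q L x + + 2 * B L x y + Q L y
  Q-sum x y = trans (Q-combine 1ℤ x 1ℤ y) (units (Q L x) (B L x y) (Q L y))
    where
    units : ∀ p q s → 1ℤ * 1ℤ * p + + 2 * (1ℤ * 1ℤ * q) + 1ℤ * 1ℤ * s ≡ p + + 2 * q + s
    units = solve-∀

  Q-difference : ∀ x y → Q L (combine 1ℤ x -1ℤ y) ≡ Q L x - + 2 * B L x y + Q L y
  Q-difference x y = trans (Q-combine 1ℤ x -1ℤ y) (units (Q L x) (B L x y) (Q L y))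
    where
    units : ∀ p q s → 1ℤ * 1ℤ * p + + 2 * (1ℤ * -1ℤ * q) + -1ℤ * -1ℤ * s ≡ p - + 2 * q + s
    units = solve-∀

  B-negate : ∀ x y → B L x (combine 0ℤ x -1ℤ y) ≡ - B L x y
  B-negate x y = trans (B-sym x _) (trans (B-combineˡ 0ℤ x -1ℤ y x) (trans (units (Q L x) (B L y x)) (cong -_ (B-sym y x))))
    where
    units : ∀ p q → 0ℤ * p + -1ℤ * q ≡ - q
    units = solve-∀

  Q-negate : ∀ x y → Q L (combine 0ℤ x -1ℤ y) ≡ Q L y
  Q-negate x y = trans (Q-combine 0ℤ x -1ℤ y) (units (Q L x) (B L x y) (Q L y))
    where
    units : ∀ p q s → 0ℤ * 0ℤ * p + + 2 * (0ℤ * -1ℤ * q) + -1ℤ * -1ℤ * s ≡ s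
    units = solve-∀

  Q-nonneg : ∀ x → 0ℤ ≤ Q L x
  Q-nonneg x with Fin.all? (λ i → x i ≟ 0ℤ)
  ... | yes x≡0 = ℤ.≤-reflexive (sym (B-zeroˡ x≡0 x))
  ... | no  x≢0 = ℤ.<⇒≤ (posDef L x x≢0)

  Gram : ∀ {k} → (Fin k → Fin r → ℤ) → Fin k → Fin k → ℤ
  Gram v i j = B L (v i) (v j)

  B-linearˡ : ∀ k c (v : Fin k → Fin r → ℤ) w → B L (linear k c v) w ≡ ∑ k (λ i → c i * B L (v i) w)
  B-linearˡ zero    c v w = B-zeroˡ (λ _ → refl) w
  B-linearˡ (suc k) c v w = begin
    B L (linear (suc k) c v) w
      ≡⟨ B-cong (λ j → +-congˡ (c zero * v zero j) (sym (ℤ.*-identityˡ (linear k c′ v′ j)))) (λ _ → refl) ⟩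
    B L (combine (c zero) (v zero) 1ℤ (linear k c′ v′)) w
      ≡⟨ B-combineˡ (c zero) (v zero) 1ℤ (linear k c′ v′) w ⟩
    c zero * B L (v zero) w + 1ℤ * B L (linear k c′ v′) w
      ≡⟨ +-congˡ (c zero * B L (v zero) w) (trans (ℤ.*-identityˡ _) (B-linearˡ k c′ v′ w)) ⟩
    ∑ (suc k) (λ i → c i * B L (v i) w) ∎
    where
    open ≡-Reasoning
    c′ : Fin k → ℤ
    c′ i = c (suc i)
    v′ : Fin k → Fin r → ℤ
    v′ i = v (suc i)

  form-Gram : ∀ k (v : Fin k → Fin r → ℤ) c → form k (Gram v) c c ≡ Q L (linear k c v)
  form-Gram k v c = sym (begin
    B L w w
      ≡⟨ B-linearˡ k c v w ⟩
    ∑ k (λ i → c i * B L (v i) w)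
      ≡⟨ ∑-cong k (λ i → cong (c i *_) (trans (B-sym (v i) w) (B-linearˡ k c v (v i)))) ⟩
    ∑ k (λ i → c i * ∑ k (λ j → c j * B L (v j) (v i)))
      ≡⟨ ∑-cong k (λ i → trans (*-distribˡ-∑ k (c i) _) (∑-cong k (λ j →
           trans (cong (λ s → c i * (c j * s)) (B-sym (v j) (v i))) (rotate (c i) (c j) (B L (v i) (v j)))))) ⟩
    form k (Gram v) c c ∎)
    where
    open ≡-Reasoning
    w = linear k c v
    rotate : ∀ a b m → a * (b * m) ≡ a * m * b
    rotate = solve-∀

  Gram-symmetric : ∀ {k} (v : Fin k → Fin r → ℤ) → Symmetric (Gram v)
  Gram-symmetric v i j = B-sym (v i) (v j)

  Gram-semidefinite : ∀ k (v : Fin k → Fin r → ℤ) → Semidefinite k (Gram v)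
  Gram-semidefinite k v c = subst (0ℤ ≤_) (sym (form-Gram k v c)) (Q-nonneg (linear k c v))

  -- More vectors than the rank satisfy a nontrivial integral relation, and its coefficients form
  -- the isotropic vector.
  Gram-isotropic : ∀ k (v : Fin k → Fin r → ℤ) → r ℕ.< k → Isotropic k (Gram v)
  Gram-isotropic k v r<k with underdetermined r<k (λ j i → v i j)
  ... | c , c≢0 , cv≡0 = c , c≢0 , trans (form-Gram k v c) (B-zeroˡ cv≡0 (linear k c v))

  -- Both Q(x + y) and Q(x - y) are nonnegative. This is cruder than Cauchy-Schwarz but involves no
  -- square root, and it makes the search finite.
  ∣B∣-bound : ∀ x y {s t} → Q L x ≡ + s → Q L y ≡ + t → ∣ B L x y ∣ ℕ.≤ ⌊ s ℕ.+ t /2⌋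
  ∣B∣-bound x y {s} {t} Qx Qy = bound (B L x y)
    (subst (0ℤ ≤_) (trans (Q-sum x y) (cong₂ (λ p q → p + + 2 * B L x y + q) Qx Qy)) (Q-nonneg (combine 1ℤ x 1ℤ y)))
    (subst (0ℤ ≤_) (trans (Q-difference x y) (cong₂ (λ p q → p - + 2 * B L x y + q) Qx Qy)) (Q-nonneg (combine 1ℤ x -1ℤ y)))
    where
    halve : ∀ k → + k + + k ≤ + s + + t → k ℕ.≤ ⌊ s ℕ.+ t /2⌋
    halve k kk≤st = subst (ℕ._≤ ⌊ s ℕ.+ t /2⌋) (sym (ℕ.n≡⌊n+n/2⌋ k)) (ℕ.⌊n/2⌋-mono (ℤ.drop‿+≤+ kk≤st))
    positive : ∀ s b t → s - + 2 * b + t ≡ s + t - (b + b)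
    positive = solve-∀
    negative : ∀ s b t → s + + 2 * b + t ≡ s + t - (- b + - b)
    negative = solve-∀
    bound : ∀ b → 0ℤ ≤ + s + + 2 * b + + t → 0ℤ ≤ + s - + 2 * b + + t → ∣ b ∣ ℕ.≤ ⌊ s ℕ.+ t /2⌋
    bound (+ k)        _ 0≤ = halve k (ℤ.0≤i-j⇒j≤i (subst (0ℤ ≤_) (positive (+ s) (+ k) (+ t)) 0≤))
    bound (-[1+ k ]) 0≤ _ = halve (suc k) (ℤ.0≤i-j⇒j≤i (subst (0ℤ ≤_) (negative (+ s) -[1+ k ] (+ t)) 0≤))

semidefinite₁ : ∀ M → Semidefinite 1 M → 0ℤ ≤ M zero zero
semidefinite₁ M M≥0 = subst (0ℤ ≤_) (units (M zero zero)) (M≥0 (λ _ → 1ℤ))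
  where
  units : ∀ m → 1ℤ * m * 1ℤ + 0ℤ + 0ℤ ≡ m
  units = solve-∀

semidefinite₂ : ∀ M → Symmetric M → Semidefinite 2 M → 0ℤ ≤ M (suc zero) (suc zero)
semidefinite₂ M M-sym M≥0 = semidefinite₁ (minor M) (minor-semidefinite M M-sym M≥0)

semidefinite₃ : ∀ M → Symmetric M → Semidefinite 3 M → 0ℤ ≤ M (suc (suc zero)) (suc (suc zero))
semidefinite₃ M M-sym M≥0 = semidefinite₂ (minor M) (λ i j → M-sym (suc i) (suc j)) (minor-semidefinite M M-sym M≥0)

isotropic₁ : ∀ M → Isotropic 1 M → M zero zero ≡ 0ℤ
isotropic₁ M (x , x≢0 , Mx≡0) = *-cancelˡ-≢0 x₀≢0 (*-cancelˡ-≢0 x₀≢0 (trans (units (x zero) (M zero zero)) Mx≡0))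
  where
  x₀≢0 : x zero ≢ 0ℤ
  x₀≢0 x₀≡0 = x≢0 λ { zero → x₀≡0 }
  units : ∀ x m → x * (x * m) ≡ x * m * x + 0ℤ + 0ℤ
  units = solve-∀

-- Bounded search over Gram matrices

allUpTo anyUpTo : ℕ → (ℕ → Bool) → Bool
allUpTo zero    f = f 0
allUpTo (suc k) f = allUpTo k f ∧ f (suc k)
anyUpTo zero    f = f 0
anyUpTo (suc k) f = anyUpTo k f ∨ f (suc k)

allBox : ℕ → (ℤ → Bool) → Bool
allBox h f = allUpTo h (λ k → f (+ k) ∧ f (- + k))

∧-left : ∀ {x y} → T (x ∧ y) → T x
∧-left p = proj₁ (Equivalence.to T-∧ p)

∧-right : ∀ {x y} → T (x ∧ y) → T y
∧-right {x} p = proj₂ (Equivalence.to (T-∧ {x}) p)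

allUpTo-sound : ∀ h f → T (allUpTo h f) → ∀ {k} → k ℕ.≤ h → T (f k)
allUpTo-sound zero    f p ℕ.z≤n = p
allUpTo-sound (suc h) f p k≤h with ℕ.m≤n⇒m<n∨m≡n k≤h
... | inj₁ (ℕ.s≤s k≤h′) = allUpTo-sound h f (∧-left p) k≤h′
... | inj₂ refl         = ∧-right {allUpTo h f} p

anyUpTo-sound : ∀ h f → T (anyUpTo h f) → ∃ λ k → T (f k)
anyUpTo-sound zero    f p = 0 , p
anyUpTo-sound (suc h) f p with Equivalence.to (T-∨ {anyUpTo h f}) p
... | inj₁ q = anyUpTo-sound h f q
... | inj₂ q = suc h , q

allBox-sound : ∀ h f → T (allBox h f) → ∀ b → ∣ b ∣ ℕ.≤ h → T (f b)
allBox-sound h f p (+ k)    k≤h = ∧-left (allUpTo-sound h _ p k≤h)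
allBox-sound h f p -[1+ k ] k≤h = ∧-right {f (+ suc k)} (allUpTo-sound h _ p k≤h)

positive negative vanishes : ℤ → Bool
positive (+ suc _) = true
positive _         = false
negative (+ _)     = false
negative -[1+ _ ]  = true
vanishes (+ 0)     = true
vanishes _         = false

radius : ℕ → ℕ → ℕ
radius s t = ⌊ s ℕ.+ t /2⌋

-- Elimination in a 4 × 4 Gram matrix with first row (a, c, x, b₁) and last column (b₁, b₂, b₃, m): p and q are
-- the entries of the first row of its Schur complement that do not involve b₁, and d is the leading entry of the
-- second one.  The leading 3 × 3 block has diagonal m₁, m₂, m₃, and b₁, b₂, b₃ range over all values compatible
-- with 2 |B(v,w)| ≤ Q v + Q w; a branch ends as soon as a diagonal entry of a Schur complement is negative.
module Elimination (a c x p q d : ℤ) (m₁ m₂ m₃ : ℕ) where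

  -- The quantity d t - w² is the single entry of the third Schur complement, equal to a² p times
  -- the determinant of the 4 × 4 Gram matrix.
  nonsingular : ℤ → ℤ → Bool
  nonsingular t w = not (vanishes (d * t - w * w))

  excludes₃ : ℕ → ℤ → ℤ → ℤ → Bool
  excludes₃ m b₁ t u = negative t ∨ allBox (radius m₃ m) (λ b₃ → nonsingular t (p * (a * b₃ - x * b₁) - q * u))

  project₂ : ℕ → ℤ → ℤ → ℤ → Bool
  project₂ m b₁ t u = excludes₃ m b₁ (p * t - u * u) u

  excludes₂ : ℕ → ℤ → ℤ → Bool
  excludes₂ m b₁ t = negative t ∨ allBox (radius m₂ m) (λ b₂ → project₂ m b₁ t (a * b₂ - c * b₁))

  excludes₁ : ℕ → Bool
  excludes₁ m = allUpTo (radius m₁ m) (λ b₁ → excludes₂ m (+ b₁) (a * + m - + b₁ * + b₁))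

  -- A negative `d` means that no three vectors have these inner products. The value `d` = 0 is
  -- rejected because the last elimination needs a positive pivot.
  refutes : Bool
  refutes = positive p ∧ (negative d ∨ not (vanishes d) ∧ anyUpTo 15 (λ j → excludes₁ (m₁ ℕ.+ j)))

open Elimination

-- The matrix entries are passed through function arguments, not let, so that evaluation shares them.
refutes₂ : (a c x p q s : ℤ) → ℕ → ℕ → ℕ → Bool
refutes₂ a c x p q s = refutes a c x p q (p * s - q * q)

refutes₁ : (a c x t₂ y t₃ : ℤ) → ℕ → ℕ → ℕ → Bool
refutes₁ a c x t₂ y t₃ = refutes₂ a c x (a * t₂ - c * c) (a * y - c * x) (a * t₃ - x * x)

refutesThird : ℕ → ℕ → ℕ → Bool
refutesThird n c t = allUpTo (radius n t) λ x → allBox (radius (suc n) t) λ y →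
  refutes₁ (+ n) (+ c) (+ x) (+ suc n) y (+ t) n (suc n) t

-- The second vector has norm n + 1, the third has norm n + j with j ≤ 4 and the fourth norm n + j with j ≤ 15;
-- B(v₀,·) ≥ 0 can be arranged by changing signs.
noTernary : ℕ → Bool
noTernary n = allUpTo (radius n (suc n)) λ c → anyUpTo 4 λ j → refutesThird n c (n ℕ.+ j)

-- Soundness of the search

positive-sound : ∀ i → T (positive i) → 0ℤ < i
positive-sound (+ suc _) _ = +<+ (ℕ.s≤s ℕ.z≤n)

nonneg-∨ : ∀ i {b} → 0ℤ ≤ i → T (negative i ∨ b) → T b
nonneg-∨ (+ _) _ p = p

nonvanishing-sound : ∀ i → T (not (vanishes i)) → i ≢ 0ℤ
nonvanishing-sound (+ 0) ()

module _ (M : Fin 4 → Fin 4 → ℤ) (M-sym : Symmetric M) (M≥0 : Semidefinite 4 M) (M-iso : Isotropic 4 M)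
         (a>0 : 0ℤ < M zero zero) (p>0 : 0ℤ < schur M zero zero) (d>0 : 0ℤ < schur (schur M) zero zero) where

  private
    S  = schur M
    S′ = schur S
    #3 : Fin 4
    #3 = suc (suc (suc zero))
    S-sym  = schur-symmetric M M-sym
    S≥0    = schur-semidefinite M M-sym a>0 M≥0
    S-iso  = schur-isotropic M M-sym a>0 M≥0 M-iso
    S′-sym = schur-symmetric S S-sym
    S′≥0   = schur-semidefinite S S-sym p>0 S≥0
    S′-iso = schur-isotropic S S-sym p>0 S≥0 S-iso
    S″≡0   = isotropic₁ (schur S′) (schur-isotropic S′ S′-sym d>0 S′≥0 S′-iso)

  -- Semidefiniteness and isotropy descend through three Schur complements to a 1 × 1 matrix, whose
  -- entry must be zero. Semidefiniteness also rules out the branches that end at a negative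
  -- diagonal entry, so the search would prove that entry nonzero.
  excludes₁-sound : ∀ m₁ m₂ m₃ m {b₁} → M zero #3 ≡ + b₁ → M #3 #3 ≡ + m →
    ∣ M zero #3 ∣ ℕ.≤ radius m₁ m → ∣ M (suc zero) #3 ∣ ℕ.≤ radius m₂ m → ∣ M (suc (suc zero)) #3 ∣ ℕ.≤ radius m₃ m →
    ¬ T (excludes₁ (M zero zero) (M zero (suc zero)) (M zero (suc (suc zero))) (S zero zero) (S zero (suc zero)) (S′ zero zero) m₁ m₂ m₃ m)
  excludes₁-sound m₁ m₂ m₃ m {b₁} M₀₃ M₃₃ h₁ h₂ h₃ ok = nonvanishing-sound (schur S′ zero zero) ok₃ S″≡0
    where
    a = M zero zero
    c = M zero (suc zero)
    x = M zero (suc (suc zero))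
    p = S zero zero
    q = S zero (suc zero)
    d = S′ zero zero
    module Stage = Elimination a c x p q d m₁ m₂ m₃
    t₁ = S (suc (suc zero)) (suc (suc zero))
    t₂ = S′ (suc zero) (suc zero)
    ok₁ : T (Stage.excludes₂ m (M zero #3) t₁)
    ok₁ = subst₂ (λ b t → T (Stage.excludes₂ m b (a * t - b * b))) (sym M₀₃) (sym M₃₃)
      (allUpTo-sound (radius m₁ m) (λ b → Stage.excludes₂ m (+ b) (a * + m - + b * + b)) ok
        (subst (λ b → ∣ b ∣ ℕ.≤ radius m₁ m) M₀₃ h₁))
    -- The numbers computed by the search are definitionally the entries of `S` and `S′`.
    ok₂ : T (Stage.excludes₃ m (M zero #3) t₂ (S zero (suc (suc zero))))
    ok₂ = allBox-sound (radius m₂ m) (λ b → Stage.project₂ m (M zero #3) t₁ (a * b - c * M zero #3))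
      (nonneg-∨ t₁ (semidefinite₃ S S-sym S≥0) ok₁) (M (suc zero) #3) h₂
    ok₃ : T (Stage.nonsingular t₂ (S′ zero (suc zero)))
    ok₃ = allBox-sound (radius m₃ m) (λ b → Stage.nonsingular t₂ (p * (a * b - x * M zero #3) - q * S zero (suc (suc zero))))
      (nonneg-∨ t₂ (semidefinite₂ S′ S′-sym S′≥0) ok₂) (M (suc (suc zero)) #3) h₃

module _ {n r : ℕ} (L : Lattice r) (universal : TightUniversal n L) (1≤n : 1 ℕ.≤ n) where

  represent : ∀ m → n ℕ.≤ m → Represents L (+ m)
  represent m n≤m = Equivalence.from (universal (+ m) m≢0) (+≤+ n≤m)
    where
    m≢0 : + m ≢ 0ℤ
    m≢0 refl = contradiction (ℕ.≤-trans 1≤n n≤m) λ ()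

  -- Passing to -w keeps the norm and flips the sign of the inner product.
  represent-acute : ∀ v m → n ℕ.≤ m → ∃ λ w → Q L w ≡ + m × ∃ λ k → B L v w ≡ + k
  represent-acute v m n≤m = orient (represent m n≤m)
    where
    orient : Represents L (+ m) → ∃ λ w → Q L w ≡ + m × ∃ λ k → B L v w ≡ + k
    orient (w , Qw) = by-sign (B L v w) refl
      where
      by-sign : ∀ b → B L v w ≡ b → ∃ λ w → Q L w ≡ + m × ∃ λ k → B L v w ≡ + k
      by-sign (+ k)    Bvw = w , Qw , k , Bvw
      by-sign -[1+ k ] Bvw = combine 0ℤ v -1ℤ w , trans (Q-negate L v w) Qw , suc k , trans (B-negate L v w) (cong -_ Bvw)

  module Triple (r<4 : r ℕ.< 4) (v₀ v₁ v₂ : Fin r → ℤ) (m₂ m₃ : ℕ)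
                (Q₀ : Q L v₀ ≡ + n) (Q₁ : Q L v₁ ≡ + m₂) (Q₂ : Q L v₂ ≡ + m₃) where

    private
      v : Fin 3 → Fin r → ℤ
      v zero             = v₀
      v (suc zero)       = v₁
      v (suc (suc zero)) = v₂
      M = Gram L v
      S = schur M
      a = M zero zero
      c = M zero (suc zero)
      x = M zero (suc (suc zero))
      p = S zero zero
      q = S zero (suc zero)
      d = schur S zero zero

    -- Universality supplies a fourth vector of the norm selected by the check. Four vectors in rank
    -- below 4 have an isotropic Gram matrix, which `excludes₁-sound` forbids.
    refutes₁-sound : ¬ T (refutes₁ (Q L v₀) (B L v₀ v₁) (B L v₀ v₂) (Q L v₁) (B L v₁ v₂) (Q L v₂) n m₂ m₃)
    refutes₁-sound ok = fourth (anyUpTo-sound 15 (λ j → excludes₁ a c x p q d n m₂ m₃ (n ℕ.+ j)) (∧-right {not (vanishes d)} ok₁))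
      where
      a>0 : 0ℤ < a
      a>0 = subst (0ℤ <_) (sym Q₀) (+<+ 1≤n)
      p>0 : 0ℤ < p
      p>0 = positive-sound p (∧-left ok)
      d≥0 : 0ℤ ≤ d
      d≥0 = semidefinite₁ (schur S) (schur-semidefinite S (schur-symmetric M (Gram-symmetric L v)) p>0
              (schur-semidefinite M (Gram-symmetric L v) a>0 (Gram-semidefinite L 3 v)))
      ok₁ = nonneg-∨ d d≥0 (∧-right {positive p} ok)
      d>0 : 0ℤ < d
      d>0 = ℤ.≤∧≢⇒< d≥0 (λ 0≡d → nonvanishing-sound d (∧-left ok₁) (sym 0≡d))
      extend : (Fin r → ℤ) → Fin 4 → Fin r → ℤ
      extend v₃ zero                   = v₀
      extend v₃ (suc zero)             = v₁
      extend v₃ (suc (suc zero))       = v₂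
      extend v₃ (suc (suc (suc zero))) = v₃
      fifth : ∀ j → T (excludes₁ a c x p q d n m₂ m₃ (n ℕ.+ j)) →
              (∃ λ w → Q L w ≡ + (n ℕ.+ j) × ∃ λ k → B L v₀ w ≡ + k) → ⊥
      fifth j ok₂ (v₃ , Q₃ , b , B₀₃) =
        excludes₁-sound (Gram L w) (Gram-symmetric L w) (Gram-semidefinite L 4 w)
          (Gram-isotropic L 4 w r<4) a>0 p>0 d>0 n m₂ m₃ (n ℕ.+ j) B₀₃ Q₃
          (∣B∣-bound L v₀ v₃ Q₀ Q₃) (∣B∣-bound L v₁ v₃ Q₁ Q₃) (∣B∣-bound L v₂ v₃ Q₂ Q₃) ok₂
        where w = extend v₃
      fourth : (∃ λ j → T (excludes₁ a c x p q d n m₂ m₃ (n ℕ.+ j))) → ⊥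
      fourth (j , ok₂) = fifth j ok₂ (represent-acute v₀ (n ℕ.+ j) (ℕ.m≤m+n n j))

  -- Each norm selected by the search is realised by a vector of L, and `∣B∣-bound` places its inner
  -- products with the earlier vectors inside the searched box.
  noTernary-sound : T (noTernary n) → 4 ℕ.≤ r
  noTernary-sound ok = ℕ.≮⇒≥ (λ r<4 → first r<4 (represent n ℕ.≤-refl))
    where
    third : r ℕ.< 4 → ∀ {v₀ v₁ c} j → Q L v₀ ≡ + n → Q L v₁ ≡ + suc n → B L v₀ v₁ ≡ + c →
            T (refutesThird n c (n ℕ.+ j)) → (∃ λ w → Q L w ≡ + (n ℕ.+ j) × ∃ λ k → B L v₀ w ≡ + k) → ⊥
    third r<4 {v₀} {v₁} {c} j Q₀ Q₁ B₀₁ ok₁ (v₂ , Q₂ , x , B₀₂) =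
      Triple.refutes₁-sound r<4 v₀ v₁ v₂ (suc n) m Q₀ Q₁ Q₂
        (transport (B L v₁ v₂) n (suc n) m (sym Q₀) (sym B₀₁) (sym B₀₂) (sym Q₁) (sym Q₂) ok₂)
      where
      m = n ℕ.+ j
      check : ℕ → ℤ → Bool
      check x y = refutes₁ (+ n) (+ c) (+ x) (+ suc n) y (+ m) n (suc n) m
      ok₂ : T (check x (B L v₁ v₂))
      ok₂ = allBox-sound (radius (suc n) m) (check x)
              (allUpTo-sound (radius n m) (λ x → allBox (radius (suc n) m) (check x)) ok₁
                (subst (λ b → ∣ b ∣ ℕ.≤ radius n m) B₀₂ (∣B∣-bound L v₀ v₂ Q₀ Q₂)))
              (B L v₁ v₂) (∣B∣-bound L v₁ v₂ Q₁ Q₂)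
      -- With all entries generalised to variables, the five equations can be matched at once.
      transport : ∀ {a a′ c c′ x x′ t t′ s s′} y m₁ m₂ m₃ → a ≡ a′ → c ≡ c′ → x ≡ x′ → t ≡ t′ → s ≡ s′ →
                  T (refutes₁ a c x t y s m₁ m₂ m₃) → T (refutes₁ a′ c′ x′ t′ y s′ m₁ m₂ m₃)
      transport _ _ _ _ refl refl refl refl refl p = p
    second : r ℕ.< 4 → ∀ {v₀} → Q L v₀ ≡ + n → (∃ λ w → Q L w ≡ + suc n × ∃ λ k → B L v₀ w ≡ + k) → ⊥
    second r<4 {v₀} Q₀ (v₁ , Q₁ , c , B₀₁) = choose (anyUpTo-sound 4 (λ j → refutesThird n c (n ℕ.+ j))
      (allUpTo-sound (radius n (suc n)) (λ c → anyUpTo 4 λ j → refutesThird n c (n ℕ.+ j)) ok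
        (subst (λ b → ∣ b ∣ ℕ.≤ radius n (suc n)) B₀₁ (∣B∣-bound L v₀ v₁ Q₀ Q₁))))
      where
      choose : (∃ λ j → T (refutesThird n c (n ℕ.+ j))) → ⊥
      choose (j , ok₁) = third r<4 {v₀} {v₁} {c} j Q₀ Q₁ B₀₁ ok₁ (represent-acute v₀ (n ℕ.+ j) (ℕ.m≤m+n n j))
    first : r ℕ.< 4 → Represents L (+ n) → ⊥
    first r<4 (v₀ , Q₀) = second r<4 {v₀} Q₀ (represent-acute v₀ (suc n) (ℕ.n≤1+n n))

-- Stated with ≡ true because Agda decides this conversion much faster than it normalises T (noTernary n).
noTernary-≤4 : ∀ {n} → 1 ℕ.≤ n → n ℕ.≤ 4 → noTernary n ≡ true
noTernary-≤4 {1} _ _ = refl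
noTernary-≤4 {2} _ _ = refl
noTernary-≤4 {3} _ _ = refl
noTernary-≤4 {4} _ _ = refl
noTernary-≤4 {suc (suc (suc (suc (suc _))))} _ (ℕ.s≤s (ℕ.s≤s (ℕ.s≤s (ℕ.s≤s ()))))

-- Classes modulo 2L

-- Packing the coordinates modulo 2 into `Fin (2 ℕ.^ r)` makes the pigeonhole principle applicable.
class : ∀ {r} → (Fin r → ℤ) → Fin (2 ℕ.^ r)
class x = funToFin (λ i → fromℕ< (n%ℕd<d (x i) 2))

same-class : ∀ {r} (x y : Fin r → ℤ) → class x ≡ class y → ∃ λ z → ∀ i → x i ≡ y i + + 2 * z i
same-class x y eq = (λ i → x i /ℕ 2 - y i /ℕ 2) , λ i → begin
  x i
    ≡⟨ a≡a%ℕn+[a/ℕn]*n (x i) 2 ⟩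
  + (x i %ℕ 2) + x i /ℕ 2 * + 2
    ≡⟨ cong (λ b → + b + x i /ℕ 2 * + 2) (bits i) ⟩
  + (y i %ℕ 2) + x i /ℕ 2 * + 2
    ≡⟨ shift (+ (y i %ℕ 2)) (x i /ℕ 2) (y i /ℕ 2) ⟩
  + (y i %ℕ 2) + y i /ℕ 2 * + 2 + + 2 * (x i /ℕ 2 - y i /ℕ 2)
    ≡⟨ cong (λ s → s + + 2 * (x i /ℕ 2 - y i /ℕ 2)) (a≡a%ℕn+[a/ℕn]*n (y i) 2) ⟨
  y i + + 2 * (x i /ℕ 2 - y i /ℕ 2) ∎
  where
  open ≡-Reasoning
  shift : ∀ b s t → b + s * + 2 ≡ b + t * + 2 + + 2 * (s - t)
  shift = solve-∀
  bits : ∀ i → x i %ℕ 2 ≡ y i %ℕ 2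
  bits i = Fin.fromℕ<-injective (x i %ℕ 2) (y i %ℕ 2) (n%ℕd<d (x i) 2) (n%ℕd<d (y i) 2)
    (trans (sym (Fin.finToFun-funToFin _ i)) (trans (cong (λ k → finToFun k i) eq) (Fin.finToFun-funToFin _ i)))

excess : ∀ {i j} → i ≤ j → ∃ λ k → j ≡ i + + k
excess {i} {j} i≤j = ∣ j - i ∣ , trans (recover i j) (+-congˡ i (sym (ℤ.0≤i⇒+∣i∣≡i (ℤ.i≤j⇒0≤j-i i≤j))))
  where
  recover : ∀ i j → j ≡ i + (j - i)
  recover = solve-∀

gap⇒positive : ∀ s j → s - + 2 * j < s + + 2 * j → ∃ λ k → j ≡ + suc k
gap⇒positive s (+ suc k)  _  = k , refl
gap⇒positive s (+ zero)   lt = contradiction lt (ℤ.<-irrefl (zero-step s))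
  where
  zero-step : ∀ s → s - + 2 * 0ℤ ≡ s + + 2 * 0ℤ
  zero-step = solve-∀
gap⇒positive s -[1+ k ] lt = contradiction lt (ℤ.≤⇒≯ (ℤ.+-monoʳ-≤ s (-2≤2 k)))
  where
  -2≤2 : ∀ k → + 2 * -[1+ k ] ≤ - (+ 2 * -[1+ k ])
  -2≤2 k = -≤+

module _ {n r : ℕ} (L : Lattice r) (universal : TightUniversal n L) where

  norm-bound : ∀ x → ¬ (∀ i → x i ≡ 0ℤ) → + n ≤ Q L x
  norm-bound x x≢0 = Equivalence.to (universal (Q L x) (λ Qx≡0 → ℤ.<⇒≢ (posDef L x x≢0) (sym Qx≡0))) (x , refl)

  -- x = u + v and y = u − v.
  record Split (x y : Fin r → ℤ) : Set where
    field
      u v : Fin r → ℤ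
      Qu≥n : + n ≤ Q L u
      Qv≥n : + n ≤ Q L v
      Qx   : Q L x ≡ Q L u + + 2 * B L u v + Q L v
      Qy   : Q L y ≡ Q L u - + 2 * B L u v + Q L v

  -- Writing x = y + 2z, take v = z and u = y + z. Then v = 0 would give x = y, and u = 0 would give
  -- x = -y.
  split : ∀ x y → class x ≡ class y → ¬ (∀ i → x i ≡ y i) → ¬ (∀ i → x i ≡ - y i) → Split x y
  split x y eq x≢y x≢-y = halves (same-class x y eq)
    where
    halves : (∃ λ z → ∀ i → x i ≡ y i + + 2 * z i) → Split x y
    halves (z , x≡y+2z) = record
      { u = u
      ; v = z
      ; Qu≥n = norm-bound u (λ u≡0 → x≢-y λ i → trans (x≡y+2z i) (opposite (y i) (z i) (u≡0 i)))
      ; Qv≥n = norm-bound z (λ z≡0 → x≢y λ i → trans (x≡y+2z i) (trans (cong (λ t → y i + + 2 * t) (z≡0 i)) (ℤ.+-identityʳ (y i))))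
      ; Qx = trans (B-cong L {x} {combine 1ℤ u 1ℤ z} {x} {combine 1ℤ u 1ℤ z} x≡u+z x≡u+z) (Q-sum L u z)
      ; Qy = trans (B-cong L y≡u-z y≡u-z) (Q-difference L u z)
      }
      where
      u : Fin r → ℤ
      u i = y i + z i
      sum : ∀ y z → y + + 2 * z ≡ 1ℤ * (y + z) + 1ℤ * z
      sum = solve-∀
      difference : ∀ y z → y ≡ 1ℤ * (y + z) + -1ℤ * z
      difference = solve-∀
      reflect : ∀ y z → y + + 2 * z ≡ + 2 * (y + z) - y
      reflect = solve-∀
      opposite : ∀ y z → y + z ≡ 0ℤ → y + + 2 * z ≡ - y
      opposite y z y+z≡0 = trans (reflect y z) (trans (cong (λ s → + 2 * s - y) y+z≡0) (ℤ.+-identityˡ (- y)))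
      x≡u+z : ∀ i → x i ≡ combine 1ℤ u 1ℤ z i
      x≡u+z i = trans (x≡y+2z i) (sum (y i) (z i))
      y≡u-z : ∀ i → y i ≡ combine 1ℤ u -1ℤ z i
      y≡u-z i = difference (y i) (z i)

  Q-opposite : ∀ x y → (∀ i → x i ≡ - y i) → Q L x ≡ Q L y
  Q-opposite x y x≡-y = trans (B-cong L x≡ x≡) (Q-negate L x y)
    where
    flip : ∀ x y → - y ≡ 0ℤ * x + -1ℤ * y
    flip = solve-∀
    x≡ : ∀ i → x i ≡ combine 0ℤ x -1ℤ y i
    x≡ i = trans (x≡-y i) (flip (x i) (y i))

  split-≢ : ∀ x y → class x ≡ class y → Q L x ≢ Q L y → Split x y
  split-≢ x y eq Qx≢Qy = split x y eq (λ x≡y → Qx≢Qy (B-cong L x≡y x≡y)) (λ x≡-y → Qx≢Qy (Q-opposite x y x≡-y))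

  -- The extremal configuration behind a coincidence of classes at norm 2n + 2.
  record MinimalPair : Set where
    field
      u v : Fin r → ℤ
      Qu  : Q L u ≡ + n
      Qv  : Q L v ≡ + n
      Buv : B L u v ≡ 1ℤ

  -- From t - s = 4 B(u,v) > 0 follows B(u,v) ≥ 1, so t = Q u + 2 B(u,v) + Q v ≥ 2n + 2. The upper
  -- bound on t turns all these inequalities into equalities.
  close : ∀ x y {s t} → class x ≡ class y → Q L x ≡ + t → Q L y ≡ + s → s ℕ.< t → t ℕ.≤ n ℕ.+ n ℕ.+ 2 →
          t ≡ n ℕ.+ n ℕ.+ 2 × MinimalPair
  close x y {s} {t} eq Qx≡t Qy≡s s<t t≤2n+2 =
    conclude (excess Qu≥n) (excess Qv≥n) (gap⇒positive (Q L u + Q L v) (B L u v) gap)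
    where
    open Split (split-≢ x y eq (λ Qx≡Qy → ℕ.<⇒≢ s<t (sym (ℤ.+-injective (trans (sym Qx≡t) (trans Qx≡Qy Qy≡s))))))
    regroup : ∀ a b c → a + b + c ≡ a + c + b
    regroup = solve-∀
    gap : Q L u + Q L v - + 2 * B L u v < Q L u + Q L v + + 2 * B L u v
    gap = subst₂ _<_ (trans (sym Qy≡s) (trans Qy (regroup (Q L u) (- (+ 2 * B L u v)) (Q L v))))
                     (trans (sym Qx≡t) (trans Qx (regroup (Q L u) (+ 2 * B L u v) (Q L v)))) (+<+ s<t)
    conclude : (∃ λ α → Q L u ≡ + n + + α) → (∃ λ β → Q L v ≡ + n + + β) → (∃ λ k → B L u v ≡ + suc k) →
               t ≡ n ℕ.+ n ℕ.+ 2 × MinimalPair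
    conclude (α , Qu) (β , Qv) (k , Buv) =
      trans t≡ (trans (cong (n ℕ.+ n ℕ.+ 2 ℕ.+_) e≡0) (ℕ.+-identityʳ _)) , record
        { u = u ; v = v
        ; Qu = trans Qu (trans (cong (λ a → + n + + a) α≡0) (ℤ.+-identityʳ (+ n)))
        ; Qv = trans Qv (trans (cong (λ a → + n + + a) β≡0) (ℤ.+-identityʳ (+ n)))
        ; Buv = trans Buv (cong (λ a → + suc a) k≡0)
        }
      where
      -- The amount by which t exceeds 2n + 2, where Q u = n + α, Q v = n + β and B(u,v) = 1 + k.
      e = α ℕ.+ (β ℕ.+ (k ℕ.+ k))
      arrange : ∀ n a b k → n + a + + 2 * (1ℤ + k) + (n + b) ≡ n + n + + 2 + (a + (b + (k + k)))
      arrange = solve-∀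
      t≡ : t ≡ n ℕ.+ n ℕ.+ 2 ℕ.+ e
      t≡ = ℤ.+-injective (trans (sym Qx≡t) (trans Qx (trans
             (trans (cong₂ (λ p q → p + + 2 * B L u v + q) Qu Qv) (cong (λ b → + n + + α + + 2 * b + (+ n + + β)) Buv))
             (arrange (+ n) (+ α) (+ β) (+ k)))))
      e≡0 : e ≡ 0
      e≡0 = ℕ.n≤0⇒n≡0 (ℕ.+-cancelˡ-≤ (n ℕ.+ n ℕ.+ 2) e 0
              (subst₂ ℕ._≤_ t≡ (sym (ℕ.+-identityʳ _)) t≤2n+2))
      α≡0 = ℕ.m+n≡0⇒m≡0 α e≡0
      β≡0 = ℕ.m+n≡0⇒m≡0 β (ℕ.m+n≡0⇒n≡0 α e≡0)
      k≡0 = ℕ.m+n≡0⇒m≡0 k (ℕ.m+n≡0⇒n≡0 β (ℕ.m+n≡0⇒n≡0 α e≡0))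

  -- If u = a + b and v = a - b with a, b ≠ 0, then 2n = Q u + Q v = 2 (Q a + Q b) ≥ 4n. The case u
  -- = v is excluded by B(u,v) = 1 < n, and u = -v by 1 ≠ -n.
  minimal-pair-distinct : 2 ℕ.≤ n → ∀ u v → Q L u ≡ + n → Q L v ≡ + n → B L u v ≡ 1ℤ → class u ≢ class v
  minimal-pair-distinct 2≤n u v Qu Qv Buv eq = contradiction too-short (ℕ.<⇒≱ (ℕ.m<m+n (n ℕ.+ n) (ℕ.≤-trans (ℕ.<⇒≤ 2≤n) (ℕ.m≤m+n n n))))
    where
    u≢v : ¬ (∀ i → u i ≡ v i)
    u≢v u≡v = ℕ.<⇒≢ 2≤n (ℤ.+-injective (trans (sym Buv) (trans (B-cong L {u} {u} {v} {u} (λ _ → refl) (λ i → sym (u≡v i))) Qu)))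
    u≢-v : ¬ (∀ i → u i ≡ - v i)
    u≢-v u≡-v = contradiction (trans (sym Buv) (trans Buv≡-Quu (cong -_ Qu))) (λ 1≡-n → clash n 1≡-n)
      where
      clash : ∀ n → 1ℤ ≢ - + n
      clash zero ()
      clash (suc n) ()
      flip : ∀ u v → u ≡ - v → v ≡ 0ℤ * u + -1ℤ * u
      flip u v refl = neg v
        where
        neg : ∀ v → v ≡ 0ℤ * (- v) + -1ℤ * (- v)
        neg = solve-∀
      Buv≡-Quu : B L u v ≡ - Q L u
      Buv≡-Quu = trans (B-cong L {u} {u} {v} {combine 0ℤ u -1ℤ u} (λ _ → refl) (λ i → flip (u i) (v i) (u≡-v i))) (B-negate L u u)
    open Split (split u v eq u≢v u≢-v) renaming (u to a; v to b)
    double : ∀ p b q → (p + + 2 * b + q) + (p - + 2 * b + q) ≡ (p + q) + (p + q)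
    double = solve-∀
    total : + n + + n ≡ (Q L a + Q L b) + (Q L a + Q L b)
    total = trans (sym (cong₂ _+_ Qu Qv)) (trans (cong₂ _+_ Qx Qy) (double (Q L a) (B L a b) (Q L b)))
    too-short : n ℕ.+ n ℕ.+ (n ℕ.+ n) ℕ.≤ n ℕ.+ n
    too-short = ℤ.drop‿+≤+ (subst (+ n + + n + (+ n + + n) ≤_) (sym total)
      (ℤ.+-mono-≤ (ℤ.+-mono-≤ Qu≥n Qv≥n) (ℤ.+-mono-≤ Qu≥n Qv≥n)))

  -- Counting classes

  module _ (1≤n : 1 ℕ.≤ n) where

    -- The leading 0 accounts for the zero vector, which occupies a class too. The length is left
    -- open because lists ending at norm 2n + 2 and at 2n + 1 both occur.
    norms : ∀ {k} → Fin (suc k) → ℕ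
    norms zero    = 0
    norms (suc i) = n ℕ.+ toℕ i

    norms-< : ∀ {k} (i j : Fin (suc k)) → i Fin.< j → norms i ℕ.< norms j
    norms-< zero    (suc j) _           = ℕ.≤-trans 1≤n (ℕ.m≤m+n n (toℕ j))
    norms-< (suc i) (suc j) (ℕ.s≤s i<j) = ℕ.+-monoʳ-< n i<j

    vectors : Fin (4 ℕ.+ n) → Fin r → ℤ
    vectors zero    = λ _ → 0ℤ
    vectors (suc i) = proj₁ (represent L universal 1≤n (n ℕ.+ toℕ i) (ℕ.m≤m+n n (toℕ i)))

    Q-vectors : ∀ i → Q L (vectors i) ≡ + norms i
    Q-vectors zero    = B-zeroˡ L (λ _ → refl) (λ _ → 0ℤ)
    Q-vectors (suc i) = proj₂ (represent L universal 1≤n (n ℕ.+ toℕ i) (ℕ.m≤m+n n (toℕ i)))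

    norms-≤ : ∀ {k} (i : Fin (2 ℕ.+ k)) → norms i ℕ.≤ n ℕ.+ k
    norms-≤     zero    = ℕ.z≤n
    norms-≤ {k} (suc i) = ℕ.+-monoʳ-≤ n (ℕ.≤-pred (Fin.toℕ<n i))

    -- The n + 4 vectors of norms 0, n, ..., 2n + 2 outnumber the classes, and two of them in one
    -- class fall under `close`.
    few-classes⇒minimal-pair : 2 ℕ.^ r ℕ.< 4 ℕ.+ n → MinimalPair
    few-classes⇒minimal-pair few = collide (Fin.pigeonhole few (λ i → class (vectors i)))
      where
      collide : (∃₂ λ i j → i Fin.< j × class (vectors i) ≡ class (vectors j)) → MinimalPair
      collide (i , j , i<j , eq) = proj₂ (close (vectors j) (vectors i) (sym eq) (Q-vectors j) (Q-vectors i)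
        (norms-< i j i<j) (subst (norms j ℕ.≤_) (trans (cong (n ℕ.+_) (ℕ.+-comm 2 n)) (sym (ℕ.+-assoc n n 2))) (norms-≤ j)))

    -- Exchanging the vector of norm 2n + 2, the only norm at which `close` permits a coincidence,
    -- for a second vector of norm n keeps the number of vectors at n + 4.
    few-classes-impossible : 2 ℕ.≤ n → 2 ℕ.^ r ℕ.< 4 ℕ.+ n → ⊥
    few-classes-impossible 2≤n few = collide (Fin.pigeonhole few (λ i → class (vectors′ i)))
      where
      open MinimalPair (few-classes⇒minimal-pair few)
      inherited : Fin (3 ℕ.+ n) → Fin r → ℤ
      inherited zero          = vectors zero
      inherited (suc zero)    = v
      -- `Fin.inject₁` leaves out the last vector, the one of norm 2n + 2.
      inherited (suc (suc i)) = vectors (suc (suc (Fin.inject₁ i)))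
      Q-inherited : ∀ i → Q L (inherited i) ≡ + norms i
      Q-inherited zero          = Q-vectors zero
      Q-inherited (suc zero)    = trans Qv (cong +_ (sym (ℕ.+-identityʳ n)))
      Q-inherited (suc (suc i)) = trans (Q-vectors (suc (suc (Fin.inject₁ i))))
        (cong (λ k → + (n ℕ.+ suc k)) (Fin.toℕ-inject₁ i))
      vectors′ : Fin (4 ℕ.+ n) → Fin r → ℤ
      vectors′ zero    = u
      vectors′ (suc i) = inherited i
      separated : ∀ x y {s t} → Q L x ≡ + t → Q L y ≡ + s → s ℕ.< t → t ℕ.≤ n ℕ.+ suc n → class x ≢ class y
      separated x y Qx Qy s<t t≤ eq = ℕ.<⇒≢ t<2n+2 (proj₁ (close x y eq Qx Qy s<t (ℕ.<⇒≤ t<2n+2)))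
        where
        t<2n+2 = ℕ.≤-trans (ℕ.s≤s t≤) (ℕ.≤-reflexive
          (trans (sym (ℕ.+-suc n (suc n))) (trans (cong (n ℕ.+_) (ℕ.+-comm 2 n)) (sym (ℕ.+-assoc n n 2)))))
      collide : (∃₂ λ i j → i Fin.< j × class (vectors′ i) ≡ class (vectors′ j)) → ⊥
      collide (zero , suc zero , _ , eq) = separated u (inherited zero) Qu (Q-inherited zero) 1≤n (ℕ.m≤m+n n (suc n)) eq
      -- Here the norms agree, so `close` does not apply.
      collide (zero , suc (suc zero) , _ , eq) = minimal-pair-distinct 2≤n u v Qu Qv Buv eq
      collide (zero , suc (suc (suc k)) , _ , eq) =
        separated (inherited (suc (suc k))) u (Q-inherited (suc (suc k))) Qu
          (ℕ.m<m+n n (ℕ.s≤s ℕ.z≤n)) (norms-≤ (suc (suc k))) (sym eq)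
      collide (suc i , suc j , ℕ.s≤s i<j , eq) =
        separated (inherited j) (inherited i) (Q-inherited j) (Q-inherited i) (norms-< i j i<j) (norms-≤ j) (sym eq)

    many-classes : 2 ℕ.≤ n → n ℕ.+ 4 ℕ.≤ 2 ℕ.^ r
    many-classes 2≤n = subst (ℕ._≤ 2 ℕ.^ r) (ℕ.+-comm 4 n) (ℕ.≮⇒≥ (few-classes-impossible 2≤n))

-- The two bounds and the divergence of t(n)

rank-bounds : ∀ n r → 1 ℕ.≤ n → IsT n r → 4 ℕ.≤ r × n ℕ.+ 4 ℕ.≤ 2 ℕ.^ r
rank-bounds n r 1≤n ((L , universal) , _) = 4≤r , n+4≤2^r
  where
  from-classes : 2 ℕ.≤ n → n ℕ.+ 4 ℕ.≤ 2 ℕ.^ r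
  from-classes = many-classes L universal 1≤n
  4≤r-large : 5 ℕ.≤ n → 4 ℕ.≤ r
  -- Rank at most 3 would give 9 ≤ n + 4 ≤ 2³.
  4≤r-large 5≤n = ℕ.≮⇒≥ λ r<4 → ℕ.<⇒≱
    (ℕ.≤-trans (ℕ.+-monoˡ-≤ 4 5≤n) (from-classes (ℕ.≤-trans (ℕ.m≤m+n 2 3) 5≤n)))
    (ℕ.^-monoʳ-≤ 2 (ℕ.≤-pred r<4))
  4≤r : 4 ℕ.≤ r
  4≤r = [ (λ n≤4 → noTernary-sound L universal 1≤n (Equivalence.from T-≡ (noTernary-≤4 1≤n n≤4))) , 4≤r-large ]′
          (ℕ.≤-<-connex n 4)
  n+4≤2^r-small : n ℕ.≤ 1 → n ℕ.+ 4 ℕ.≤ 2 ℕ.^ r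
  -- For n = 1 the rank bound suffices: 5 ≤ 5 + 11 = 2⁴ ≤ 2^r.
  n+4≤2^r-small n≤1 = ℕ.≤-trans (ℕ.+-monoˡ-≤ 4 n≤1) (ℕ.≤-trans (ℕ.m≤m+n 5 11) (ℕ.^-monoʳ-≤ 2 4≤r))
  n+4≤2^r : n ℕ.+ 4 ℕ.≤ 2 ℕ.^ r
  n+4≤2^r = [ n+4≤2^r-small , from-classes ]′ (ℕ.≤-<-connex n 1)

theorem4p1 : (∀ (n r : ℕ) → 1 ℕ.≤ n → IsT n r → (4 ℕ.≤ r) × (n ℕ.+ 4 ℕ.≤ 2 ℕ.^ r))
  × (∀ (K : ℕ) → Σ ℕ (λ N → ∀ (n r : ℕ) → 1 ℕ.≤ n → N ℕ.≤ n → IsT n r → K ℕ.≤ r))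
-- With N = 2^K, a rank r < K would give n + 4 ≤ 2^r ≤ 2^K ≤ n.
theorem4p1 = rank-bounds , λ K → 2 ℕ.^ K , λ n r 1≤n 2^K≤n isT → ℕ.≮⇒≥ λ r<K →
  ℕ.<⇒≱ (ℕ.m<m+n n (ℕ.s≤s ℕ.z≤n)) (ℕ.≤-trans (proj₂ (rank-bounds n r 1≤n isT)) (ℕ.≤-trans (ℕ.^-monoʳ-≤ 2 (ℕ.<⇒≤ r<K)) 2^K≤n))
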